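{- Let $r=\langle L\leftarrow K\rightarrow R\rangle$ be a rule over $\mathcal L$ and let $g:L\to G$ be an injective graph morphism. Then there exist graphs $D,H$ and morphisms $K\to D$, $D\to G$, $R\to H$, $D\to H$ such that both squares of the diagram $$\begin{array}{ccccc} L & \leftarrow & K & \rightarrow & R\\ \downarrow g & & \downarrow & & \downarrow\\ G & \leftarrow & D & \rightarrow & H\end{array}$$ commute and are natural pushouts (a natural double pushout) if and only if $g$ satisfies the dangling condition. In this case $D$ and $H$ are unique up to isomorphism, and for a TLRG $G$ they coincide (up to isomorphism) with the intermediate graph and result graph of the rule application construction. Moreover, if $G\Rightarrow_r H$, then $G$ is a TLRG if and only if $H$ is a TLRG.
   Context: Fix a label alphabet $\mathcal L=(\mathcal L_V,\mathcal L_E)$ of finite sets. A graph over $\mathcal L$ is a tuple $G=(V,E,s,t,l,m,p)$ where $V,E$ are finite sets, $s,t:E\to V$ are total (source and target), $l:V\rightharpoonup\mathcal L_V$ is a partial node labelling, $m:E\to\mathcal L_E$ is a total edge labelling, and $p:V\rightharpoonup\{0,1\}$ is a partial rootedness function ($1$ = root, $0$ = non-root). $G$ is a TLRG (totally labelled, totally rooted graph) if $l$ and $p$ are total. A morphism $g:G\to H$ is a pair $(g_V:V_G\to V_H,g_E:E_G\to E_H)$ with $g_V\circ s_G=s_H\circ g_E$, $g_V\circ t_G=t_H\circ g_E$, $m_H\circ g_E=m_G$, $l_H(g_V(v))=l_G(v)$ whenever $l_G(v)$ is defined, and $p_H(g_V(v))=p_G(v)$ whenever $p_G(v)$ is defined.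 Graphs and morphisms form a category; pushouts and pullbacks are taken there, and a natural pushout is a commuting square that is both a pushout and a pullback. A morphism is injective if both components are injective; an isomorphism is a bijective morphism whose inverse is a morphism. A rule $r=\langle L\leftarrow K\rightarrow R\rangle$ consists of TLRGs $L,R$ and a graph $K$ that is a subgraph of both $L$ and $R$ (i.e. $V_K\subseteq V_L$, $E_K\subseteq E_L$, $s_K,t_K,m_K$ are restrictions of $s_L,t_L,m_L$, and $l_K\subseteq l_L$, $p_K\subseteq p_L$ as sets of pairs; likewise for $R$), the two arrows being the inclusions. An injective morphism $g:L\to G$ satisfies the dangling condition if no edge of $G$ not in $g(L)$ is incident to a node in $g(V_L\setminus V_K)$. Applying $r$ to a TLRG $G$ via such $g$: (1) delete from $G$ the images of the nodes and edges of $L$ not in $K$, and for each node $v$ of $K$ whose label (resp. rootedness) is undefined, make the label (resp. rootedness) of $g_V(v)$ undefined, giving the intermediate graph $D$; (2) add disjointly the nodes and edges of $R$ not in $K$ with their labels and rootedness (edges attached via $g$ on nodes of $K$), and for each node $v$ of $K$ with undefined label (resp. rootedness), set the label (resp. rootedness) of $g_V(v)$ to $l_R(v)$ (resp. $p_R(v)$), giving the result graph $H$. One writes $G\Rightarrow_{r,g}M$ or $G\Rightarrow_r M$ if $M\cong H$ for such a match $g$ satisfying the dangling condition. -}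

module Defs where

open import Data.Bool.Base using (Bool)
open import Data.Empty.Irrelevant using () renaming (⊥-elim to ⊥-elim-irr)
open import Data.Fin.Base using (Fin; zero; suc)
import Data.Fin.Properties as Fin
open import Data.Irrelevant as Irrelevant using ([_])
open import Data.Maybe using (Is-just)
open import Data.Maybe.Base using (Maybe; just; nothing)
open import Data.Nat.Base using (ℕ; zero; suc)
open import Data.Product using (∃!)
open import Data.Product.Base using (Σ; ∃; _×_; _,_; proj₁; proj₂; map)
open import Data.Refinement using (Refinement; Refinement-syntax; _,_; value; value-injective)
open import Data.Sum.Base using (_⊎_; inj₁; inj₂)
open import Data.Sum.Function.Propositional using (_⊎-↔_)
open import Function.Base using (_∘_)
open import Function.Bundles using (_↔_; Inverse; mk↔ₛ′)
open import Function.Construct.Composition using (_↔-∘_)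
open import Function.Construct.Symmetry using (↔-sym)
open import Function.Definitions using (Inverseᵇ)
import Function.Definitions as Fun
open import Function.Properties.Inverse using (↔⇒↣)
open import Relation.Binary.Definitions using (DecidableEquality)
open import Relation.Binary.PropositionalEquality
  using (_≡_; refl; sym; trans; cong; subst)
open import Relation.Nullary using (¬_; Dec; yes; no)
open import Relation.Nullary.Decidable using (map′; ¬?; _×-dec_; via-injection)
open import Relation.Unary using (Pred; Decidable)
open import Level using (0ℓ)

------------------------------------------------------------------------
-- Finite sets

Finite : Set → Set
Finite A = ∃ λ n → A ↔ Fin n

private
  variable
    A B : Set

infix 4 _∈Im_

_∈Im_ : B → (A → B) → Set
y ∈Im f = ∃ λ x → f x ≡ y

finite-≟ : Finite A → DecidableEquality A
finite-≟ (_ , A↔Fin) = via-injection (↔⇒↣ A↔Fin) Fin._≟_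

finite-any? : Finite A → {P : Pred A 0ℓ} → Decidable P → Dec (∃ P)
finite-any? (_ , A↔Fin) {P} P? =
  map′ (map from (λ p → p))
       (λ (a , p) → to a , subst P (sym (strictlyInverseʳ a)) p)
       (Fin.any? (P? ∘ from))
  where open Inverse A↔Fin

∈Im? : Finite A → Finite B → (f : A → B) → Decidable (_∈Im f)
∈Im? finA finB f y = finite-any? finA (λ x → finite-≟ finB (f x) y)

finite-⊎ : Finite A → Finite B → Finite (A ⊎ B)
finite-⊎ (_ , A↔Fin) (_ , B↔Fin) = _ , ↔-sym Fin.+↔⊎ ↔-∘ (A↔Fin ⊎-↔ B↔Fin)

private
  finite-refine-Fin : ∀ {n} {P : Pred (Fin n) 0ℓ} → Decidable P →
                      Finite [ i ∈ Fin n ∣ P i ]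
  finite-refine-Fin {zero} P? =
    0 , mk↔ₛ′ (λ { (() , _) }) (λ ()) (λ ()) (λ { (() , _) })
  finite-refine-Fin {suc n} {P} P? with P? zero | finite-refine-Fin (P? ∘ suc)
  ... | yes p | k , φ = suc k , mk↔ₛ′ f g fg gf
    where
    open Inverse φ
    f : [ i ∈ Fin (suc n) ∣ P i ] → Fin (suc k)
    f (zero  , _) = zero
    f (suc i , q) = suc (to (i , q))
    g : Fin (suc k) → [ i ∈ Fin (suc n) ∣ P i ]
    g zero    = zero , [ p ]
    g (suc j) = suc (value (from j)) , Refinement.proof (from j)
    fg : ∀ j → f (g j) ≡ j
    fg zero    = refl
    fg (suc j) = cong suc (strictlyInverseˡ j)
    gf : ∀ x → g (f x) ≡ x
    gf (zero  , _) = refl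
    gf (suc i , q) = value-injective (cong (suc ∘ value) (strictlyInverseʳ (i , q)))
  ... | no ¬p | k , φ = k , mk↔ₛ′ f g strictlyInverseˡ gf
    where
    open Inverse φ
    f : [ i ∈ Fin (suc n) ∣ P i ] → Fin k
    f (zero  , [ q ]) = ⊥-elim-irr (¬p q)
    f (suc i , q)     = to (i , q)
    g : Fin k → [ i ∈ Fin (suc n) ∣ P i ]
    g j = suc (value (from j)) , Refinement.proof (from j)
    gf : ∀ x → g (f x) ≡ x
    gf (zero  , [ q ]) = ⊥-elim-irr (¬p q)
    gf (suc i , q)     = value-injective (cong (suc ∘ value) (strictlyInverseʳ (i , q)))

finite-refine : Finite A → {P : Pred A 0ℓ} → Decidable P → Finite [ x ∈ A ∣ P x ]
finite-refine {A} (n , A↔Fin) {P} P? = _ , proj₂ (finite-refine-Fin (P? ∘ from)) ↔-∘ transport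
  where
  open Inverse A↔Fin
  transport : [ x ∈ A ∣ P x ] ↔ [ i ∈ Fin n ∣ P (from i) ]
  transport = mk↔ₛ′
    (λ (x , p) → to x , Irrelevant.map (subst P (sym (strictlyInverseʳ x))) p)
    (λ (i , p) → from i , p)
    (λ (i , _) → value-injective (strictlyInverseˡ i))
    (λ (x , _) → value-injective (strictlyInverseʳ x))

------------------------------------------------------------------------
-- The category of graphs over an alphabet

record Alphabet : Set₁ where
  field
    NodeLabel EdgeLabel : Set
    finite-NodeLabel    : Finite NodeLabel
    finite-EdgeLabel    : Finite EdgeLabel

open Alphabet public

-- Partial functions are functions into Maybe; for rootedness, just true
-- is a root, just false a non-root and nothing is undefined.

record Graph (𝓛 : Alphabet) : Set₁ where
  field
    V E      : Set
    finite-V : Finite V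
    finite-E : Finite E
    s t      : E → V
    l        : V → Maybe (NodeLabel 𝓛)
    m        : E → EdgeLabel 𝓛
    p        : V → Maybe Bool

open Graph public

variable
  𝓛 : Alphabet

IsTLRG : Graph 𝓛 → Set
IsTLRG G = (∀ v → Is-just (l G v)) × (∀ v → Is-just (p G v))

infix 4 _⟶_ _≈_ _≅_
infixr 9 _∘ᴳ_

record _⟶_ {𝓛 : Alphabet} (G H : Graph 𝓛) : Set where
  field
    fV     : V G → V H
    fE     : E G → E H
    pres-s : ∀ e → fV (s G e) ≡ s H (fE e)
    pres-t : ∀ e → fV (t G e) ≡ t H (fE e)
    pres-m : ∀ e → m H (fE e) ≡ m G e
    pres-l : ∀ v {a} → l G v ≡ just a → l H (fV v) ≡ just a
    pres-p : ∀ v {b} → p G v ≡ just b → p H (fV v) ≡ just b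

open _⟶_ public

_≈_ : {G H : Graph 𝓛} → G ⟶ H → G ⟶ H → Set
f ≈ g = (∀ v → fV f v ≡ fV g v) × (∀ e → fE f e ≡ fE g e)

_∘ᴳ_ : {G H J : Graph 𝓛} → H ⟶ J → G ⟶ H → G ⟶ J
g ∘ᴳ f = record
  { fV     = fV g ∘ fV f
  ; fE     = fE g ∘ fE f
  ; pres-s = λ e → trans (cong (fV g) (pres-s f e)) (pres-s g (fE f e))
  ; pres-t = λ e → trans (cong (fV g) (pres-t f e)) (pres-t g (fE f e))
  ; pres-m = λ e → trans (pres-m g (fE f e)) (pres-m f e)
  ; pres-l = λ v → pres-l g (fV f v) ∘ pres-l f v
  ; pres-p = λ v → pres-p g (fV f v) ∘ pres-p f v
  }

Injective : {G H : Graph 𝓛} → G ⟶ H → Set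
Injective f = Fun.Injective _≡_ _≡_ (fV f) × Fun.Injective _≡_ _≡_ (fE f)

record _≅_ {𝓛 : Alphabet} (G H : Graph 𝓛) : Set where
  field
    to       : G ⟶ H
    from     : H ⟶ G
    inverseV : Inverseᵇ _≡_ _≡_ (fV to) (fV from)
    inverseE : Inverseᵇ _≡_ _≡_ (fE to) (fE from)

--      f
--   A ───▶ B
--  g│      │h
--   ▼      ▼
--   C ───▶ D
--      k

record IsPushout {𝓛 : Alphabet} {A B C D : Graph 𝓛}
                 (f : A ⟶ B) (g : A ⟶ C) (h : B ⟶ D) (k : C ⟶ D) : Set₁ where
  field
    commutes  : h ∘ᴳ f ≈ k ∘ᴳ g
    universal : {X : Graph 𝓛} (h′ : B ⟶ X) (k′ : C ⟶ X) → h′ ∘ᴳ f ≈ k′ ∘ᴳ g →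
                ∃! _≈_ λ (u : D ⟶ X) → (u ∘ᴳ h ≈ h′) × (u ∘ᴳ k ≈ k′)

record IsPullback {𝓛 : Alphabet} {A B C D : Graph 𝓛}
                  (f : A ⟶ B) (g : A ⟶ C) (h : B ⟶ D) (k : C ⟶ D) : Set₁ where
  field
    commutes  : h ∘ᴳ f ≈ k ∘ᴳ g
    universal : {X : Graph 𝓛} (f′ : X ⟶ B) (g′ : X ⟶ C) → h ∘ᴳ f′ ≈ k ∘ᴳ g′ →
                ∃! _≈_ λ (u : X ⟶ A) → (f ∘ᴳ u ≈ f′) × (g ∘ᴳ u ≈ g′)

IsNaturalPushout : {A B C D : Graph 𝓛} →
                   A ⟶ B → A ⟶ C → B ⟶ D → C ⟶ D → Set₁
IsNaturalPushout f g h k = IsPushout f g h k × IsPullback f g h k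

------------------------------------------------------------------------
-- Rules

-- Types have no literal subsets, so "K is a subgraph of L" is given by an
-- injective morphism: being a morphism says that s, t, m restrict and that
-- l K ⊆ l L, p K ⊆ p L as sets of pairs.

record Rule (𝓛 : Alphabet) : Set₁ where
  field
    L K R   : Graph 𝓛
    L-TLRG  : IsTLRG L
    R-TLRG  : IsTLRG R
    inL     : K ⟶ L
    inR     : K ⟶ R
    inL-inj : Injective inL
    inR-inj : Injective inR

open Rule public

Dangling : (r : Rule 𝓛) {G : Graph 𝓛} → L r ⟶ G → Set
Dangling r {G} g =
  ∀ e → ¬ (e ∈Im fE g) →
  ∀ v → ¬ (v ∈Im fV (inL r)) →
  ¬ (s G e ≡ fV g v ⊎ t G e ≡ fV g v)

record NaturalDoublePushout (r : Rule 𝓛) {G : Graph 𝓛} (g : L r ⟶ G) : Set₁ where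
  field
    D H   : Graph 𝓛
    K⟶D   : K r ⟶ D
    D⟶G   : D ⟶ G
    R⟶H   : R r ⟶ H
    D⟶H   : D ⟶ H
    left  : IsNaturalPushout (inL r) K⟶D g D⟶G
    right : IsNaturalPushout (inR r) K⟶D R⟶H D⟶H

------------------------------------------------------------------------
-- Rule application

module Application (r : Rule 𝓛) {G : Graph 𝓛} (g : L r ⟶ G)
                   (g-inj : Injective g) (dangling : Dangling r g) where

  gK : V (K r) → V G
  gK = fV g ∘ fV (inL r)

  DeletedV : V G → Set
  DeletedV v = ∃ λ w → ¬ (w ∈Im fV (inL r)) × fV g w ≡ v

  DeletedE : E G → Set
  DeletedE e = ∃ λ d → ¬ (d ∈Im fE (inL r)) × fE g d ≡ e

  deletedV? : Decidable DeletedV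
  deletedV? v = finite-any? (finite-V (L r)) λ w →
    ¬? (∈Im? (finite-V (K r)) (finite-V (L r)) (fV (inL r)) w)
      ×-dec finite-≟ (finite-V G) (fV g w) v

  deletedE? : Decidable DeletedE
  deletedE? e = finite-any? (finite-E (L r)) λ d →
    ¬? (∈Im? (finite-E (K r)) (finite-E (L r)) (fE (inL r)) d)
      ×-dec finite-≟ (finite-E G) (fE g d) e

  VD ED : Set
  VD = [ v ∈ V G ∣ ¬ DeletedV v ]
  ED = [ e ∈ E G ∣ ¬ DeletedE e ]

  gK-kept : ∀ k → ¬ DeletedV (gK k)
  gK-kept k (w , w∉K , gw≡) = w∉K (k , sym (proj₁ g-inj gw≡))

  private
    endpoint-kept :
      (endG : E G → V G) (endL : E (L r) → V (L r)) (endK : E (K r) → V (K r)) →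
      (∀ d → fV g (endL d) ≡ endG (fE g d)) →
      (∀ k → fV (inL r) (endK k) ≡ endL (fE (inL r) k)) →
      (∀ e → ¬ (e ∈Im fE g) → ∀ v → ¬ (v ∈Im fV (inL r)) → ¬ (endG e ≡ fV g v)) →
      ∀ {e} → ¬ DeletedE e → ¬ DeletedV (endG e)
    endpoint-kept endG endL endK presG presL dang {e} kept (w , w∉K , gw≡) =
      dang e e∉g w w∉K (sym gw≡)
      where
      e∉g : ¬ (e ∈Im fE g)
      e∉g (d , refl) = kept (d , d∉K , refl)
        where
        d∉K : ¬ (d ∈Im fE (inL r))
        d∉K (k , refl) =
          w∉K (endK k , trans (presL k) (sym (proj₁ g-inj (trans gw≡ (sym (presG d))))))

  sD tD : ED → VD
  sD (e , kept) = s G e , Irrelevant.map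
    (endpoint-kept (s G) (s (L r)) (s (K r)) (pres-s g) (pres-s (inL r))
      (λ e e∉g v v∉K → dangling e e∉g v v∉K ∘ inj₁)) kept
  tD (e , kept) = t G e , Irrelevant.map
    (endpoint-kept (t G) (t (L r)) (t (K r)) (pres-t g) (pres-t (inL r))
      (λ e e∉g v v∉K → dangling e e∉g v v∉K ∘ inj₂)) kept

  -- Labels and rootedness are treated alike.  For a partial attribute aK of
  -- the interface, Cleared aK v says that v is the image of an interface
  -- node on which aK is undefined (that node is unique, as g is injective).
  module _ {A : Set} where

    Cleared : (V (K r) → Maybe A) → V G → Set
    Cleared aK v = ∃ λ k → aK k ≡ nothing × gK k ≡ v

    private
      ≡nothing? : (x : Maybe A) → Dec (x ≡ nothing)
      ≡nothing? nothing  = yes refl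
      ≡nothing? (just _) = no λ ()

    cleared? : (aK : V (K r) → Maybe A) → Decidable (Cleared aK)
    cleared? aK v = finite-any? (finite-V (K r)) λ k →
      ≡nothing? (aK k) ×-dec finite-≟ (finite-V G) (gK k) v

    attrD : (V (K r) → Maybe A) → (V G → Maybe A) → VD → Maybe A
    attrD aK aG (v , _) with cleared? aK v
    ... | yes _ = nothing
    ... | no  _ = aG v

  intermediate : Graph 𝓛
  intermediate = record
    { V        = VD
    ; E        = ED
    ; finite-V = finite-refine (finite-V G) (¬? ∘ deletedV?)
    ; finite-E = finite-refine (finite-E G) (¬? ∘ deletedE?)
    ; s        = sD
    ; t        = tD
    ; l        = attrD (l (K r)) (l G)
    ; m        = m G ∘ value
    ; p        = attrD (p (K r)) (p G)
    }

  VR∖K ER∖K : Set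
  VR∖K = [ v ∈ V (R r) ∣ ¬ (v ∈Im fV (inR r)) ]
  ER∖K = [ e ∈ E (R r) ∣ ¬ (e ∈Im fE (inR r)) ]

  VH EH : Set
  VH = VD ⊎ VR∖K
  EH = ED ⊎ ER∖K

  ∈VK? : Decidable (_∈Im fV (inR r))
  ∈VK? = ∈Im? (finite-V (K r)) (finite-V (R r)) (fV (inR r))

  ∈EK? : Decidable (_∈Im fE (inR r))
  ∈EK? = ∈Im? (finite-E (K r)) (finite-E (R r)) (fE (inR r))

  attach : V (R r) → VH
  attach v with ∈VK? v
  ... | yes (k , _) = inj₁ (gK k , [ gK-kept k ])
  ... | no  v∉K     = inj₂ (v , [ v∉K ])

  sH tH : EH → VH
  sH (inj₁ e) = inj₁ (sD e)
  sH (inj₂ e) = attach (s (R r) (value e))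
  tH (inj₁ e) = inj₁ (tD e)
  tH (inj₂ e) = attach (t (R r) (value e))

  mH : EH → EdgeLabel 𝓛
  mH (inj₁ e) = m G (value e)
  mH (inj₂ e) = m (R r) (value e)

  attrH : {A : Set} → (V (K r) → Maybe A) → (V G → Maybe A) → (V (R r) → Maybe A) →
          VH → Maybe A
  attrH aK aG aR (inj₂ v) = aR (value v)
  attrH aK aG aR (inj₁ v) with cleared? aK (value v)
  ... | yes (k , _) = aR (fV (inR r) k)
  ... | no  _       = attrD aK aG v

  result : Graph 𝓛
  result = record
    { V        = VH
    ; E        = EH
    ; finite-V = finite-⊎ (finite-V intermediate) (finite-refine (finite-V (R r)) (¬? ∘ ∈VK?))
    ; finite-E = finite-⊎ (finite-E intermediate) (finite-refine (finite-E (R r)) (¬? ∘ ∈EK?))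
    ; s        = sH
    ; t        = tH
    ; l        = attrH (l (K r)) (l G) (l (R r))
    ; m        = mH
    ; p        = attrH (p (K r)) (p G) (p (R r))
    }

open Application public using (intermediate; result)

-- The construction makes sense verbatim when G is not a TLRG, and _⇒[_]_
-- is not restricted to TLRGs, so that "G is a TLRG if and only if M is"
-- has content in both directions.

infix 4 _⇒[_]_

_⇒[_]_ : Graph 𝓛 → Rule 𝓛 → Graph 𝓛 → Set
G ⇒[ r ] M = Σ (L r ⟶ G) λ g → Σ (Injective g) λ g-inj → Σ (Dangling r g) λ dangling →
  M ≅ result r g g-inj dangling

{-# OPTIONS --safe #-}

-- A square f : A → B, g : A → C, h : B → D, k : C → D of graphs with f and h
-- injective is a natural pushout exactly when it is a gluing: on nodes and on
-- edges D is the union of B and C with intersection A, every label of D comes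
-- from B or from C, and a node of A is labelled as soon as both of its images
-- are.  Colouring D with two colours, deleting the labels of D that come from
-- neither B nor C, and mapping in a single labelled node show that these
-- conditions are necessary.  The dangling condition, the construction of D and H
-- and the uniqueness of D are then elementary statements about gluings, and H is
-- unique as a pushout.

module Submission where

open import Defs
open import Data.Bool.Base using (Bool; true; false)
open import Data.Bool.Properties using () renaming (_≟_ to _≟ᵇ_)
open import Data.Empty using (⊥)
import Data.Fin.Properties as Fin
open import Data.Irrelevant using ([_])
open import Data.Maybe using (Is-just)
open import Data.Maybe.Base using (Maybe; just; nothing)
open import Data.Maybe.Properties using () renaming (≡-dec to ≡-decᵐ)
open import Data.Maybe.Relation.Unary.Any using (just)
open import Data.Product.Base using (∃; _×_; _,_; proj₁; proj₂)
open import Data.Product.Function.NonDependent.Propositional using (_×-↔_)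
open import Data.Refinement using (Refinement-syntax; _,_; value; value-injective)
open import Data.Sum.Base using (_⊎_; inj₁; inj₂; [_,_]′)
open import Data.Sum.Properties using (inj₁-injective)
open import Data.Unit.Base using (⊤; tt)
open import Function.Base using (_∘_; id; const)
open import Function.Bundles using (_⇔_; mk⇔)
open import Function.Construct.Composition using (_↔-∘_; _⇔-∘_)
open import Function.Construct.Symmetry using (↔-sym; ⇔-sym)
import Function.Definitions as Fun
open import Relation.Binary.Definitions using (DecidableEquality)
open import Relation.Binary.PropositionalEquality
  using (_≡_; refl; sym; trans; cong; cong₂; subst)
open import Relation.Nullary using (¬_; yes; no; does)
open import Relation.Nullary.Decidable using (_×-dec_; _⊎-dec_; dec-true; dec-false)
open import Relation.Nullary.Negation using (contradiction; contradiction-irr)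
open import Relation.Unary using (Decidable)

private
  variable
    A B C D C′ X Y : Set

-- Injections and small finite sets.

Inj : (A → B) → Set
Inj = Fun.Injective _≡_ _≡_

finite-× : Finite A → Finite B → Finite (A × B)
finite-× (_ , A↔Fin) (_ , B↔Fin) = _ , ↔-sym Fin.*↔× ↔-∘ (A↔Fin ×-↔ B↔Fin)

finite-Bool : Finite Bool
finite-Bool = 2 , ↔-sym Fin.2↔Bool

finite-⊤ : Finite ⊤
finite-⊤ = 1 , ↔-sym Fin.1↔⊤

finite-⊥ : Finite ⊥
finite-⊥ = 0 , ↔-sym Fin.0↔⊥

-- Gluings of sets and of attributes

record Gluing (f : A → B) (g : A → C) (h : B → D) (k : C → D) : Set where
  field
    commutes : ∀ a → h (f a) ≡ k (g a)
    f-inj    : Inj f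
    h-inj    : Inj h
    k-inj    : Inj k
    cover    : ∀ d → d ∈Im h ⊎ d ∈Im k
    meet     : ∀ {b c} → h b ≡ k c → ∃ λ a → f a ≡ b × g a ≡ c

module Copairing {f : A → B} {g : A → C} {h : B → D} {k : C → D} (gl : Gluing f g h k)
                 (h′ : B → X) (k′ : C → X) (agree : ∀ a → h′ (f a) ≡ k′ (g a)) where
  open Gluing gl

  copair : D → X
  copair d = [ h′ ∘ proj₁ , k′ ∘ proj₁ ]′ (cover d)

  -- An element of `D` reached from both sides comes from `A`, where `h′` and `k′` agree, so the
  -- side that `cover` picks does not affect `copair`.
  copair-meet : ∀ {b c} → h b ≡ k c → h′ b ≡ k′ c
  copair-meet hb≡kc with meet hb≡kc
  ... | a , refl , refl = agree a

  copair-h : ∀ b → copair (h b) ≡ h′ b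
  copair-h b with cover (h b)
  ... | inj₁ (_ , hb₁≡hb) = cong h′ (h-inj hb₁≡hb)
  ... | inj₂ (_ , kc≡hb)  = sym (copair-meet (sym kc≡hb))

  copair-k : ∀ c → copair (k c) ≡ k′ c
  copair-k c with cover (k c)
  ... | inj₁ (_ , hb≡kc)  = copair-meet hb≡kc
  ... | inj₂ (_ , kc₁≡kc) = cong k′ (k-inj kc₁≡kc)

-- `support` is what a pushout forces on a partial attribute, `reflect` what a pullback forces on
-- it.
record AttrGluing (f : A → B) (g : A → C) (h : B → D) (k : C → D)
                  (aA : A → Maybe X) (aB : B → Maybe X)
                  (aC : C → Maybe X) (aD : D → Maybe X) : Set where
  field
    support : ∀ d {x} → aD d ≡ just x →
              (∃ λ b → h b ≡ d × aB b ≡ just x) ⊎ (∃ λ c → k c ≡ d × aC c ≡ just x)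
    reflect : ∀ a {x} → aB (f a) ≡ just x → aC (g a) ≡ just x → aA a ≡ just x

Preserves : (A → B) → (A → Maybe X) → (B → Maybe X) → Set
Preserves f aA aB = ∀ a {x} → aA a ≡ just x → aB (f a) ≡ just x

module ComplementMap {f : A → B} {h : B → D} {g : A → C} {k : C → D} {g′ : A → C′} {k′ : C′ → D}
                     (gl : Gluing f g h k) (gl′ : Gluing f g′ h k′) where
  private
    module G  = Gluing gl
    module G′ = Gluing gl′

  -- When `cover` places `k c` in the image of `h`, `meet` in the first gluing shows that `c` comes
  -- from `A`, and `g′` then leads into `C′`.
  lifts : ∀ c → ∃ λ c′ → k′ c′ ≡ k c
  lifts c with G′.cover (k c)
  ... | inj₂ c′ = c′
  ... | inj₁ (b , hb≡kc) with G.meet hb≡kc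
  ...   | a , refl , refl = g′ a , trans (sym (G′.commutes a)) hb≡kc

  lift : C → C′
  lift = proj₁ ∘ lifts

  k′-lift : ∀ c → k′ (lift c) ≡ k c
  k′-lift = proj₂ ∘ lifts

  lift-g : ∀ a → lift (g a) ≡ g′ a
  lift-g a = G′.k-inj (trans (k′-lift (g a)) (trans (sym (G.commutes a)) (G′.commutes a)))

  -- The label of `c` reappears at `k c`, and the second gluing finds its source. If that source
  -- lies in `C′`, it is `lift c`. If it lies in `B`, then `c` comes from some `a`; `reflect` in the
  -- first gluing labels `a`, and `g′` carries the label on.
  lift-preserves : {aA : A → Maybe X} {aB : B → Maybe X} {aC : C → Maybe X}
                   {aC′ : C′ → Maybe X} {aD : D → Maybe X} →
                   AttrGluing f g h k aA aB aC aD → AttrGluing f g′ h k′ aA aB aC′ aD →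
                   Preserves k aC aD → Preserves g′ aA aC′ → Preserves lift aC aC′
  lift-preserves {aC′ = aC′} ag ag′ k-pres g′-pres c aCc≡
    with AttrGluing.support ag′ (k c) (k-pres c aCc≡)
  ... | inj₂ (c′ , k′c′≡kc , aC′c′≡) =
    trans (cong aC′ (G′.k-inj (trans (k′-lift c) (sym k′c′≡kc)))) aC′c′≡
  ... | inj₁ (b , hb≡kc , aBb≡) with G.meet hb≡kc
  ...   | a , refl , refl =
    trans (cong aC′ (lift-g a)) (g′-pres a (AttrGluing.reflect ag a aBb≡ aCc≡))

-- Colourings detect gluings

-- The universal property of a pushout of sets, tested only against two colours, with existence and
-- uniqueness separated. Indicator functions make two colours enough.
record ColourPushout (f : A → B) (g : A → C) (h : B → D) (k : C → D) : Set where
  field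
    glue   : (β : B → Bool) (γ : C → Bool) → (∀ a → β (f a) ≡ γ (g a)) →
             ∃ λ (δ : D → Bool) → (∀ b → δ (h b) ≡ β b) × (∀ c → δ (k c) ≡ γ c)
    unique : (δ δ′ : D → Bool) → (∀ b → δ (h b) ≡ δ′ (h b)) → (∀ c → δ (k c) ≡ δ′ (k c)) →
             ∀ d → δ d ≡ δ′ d

true≢false : ¬ (true ≡ false)
true≢false ()

module _ {f : A → B} {g : A → C} {h : B → D} {k : C → D}
         (finA : Finite A) (finB : Finite B) (finC : Finite C) (finD : Finite D)
         (commutes : ∀ a → h (f a) ≡ k (g a)) (f-inj : Inj f) (h-inj : Inj h)
         (cp : ColourPushout f g h k) where

  private
    open ColourPushout cp

    _≟B_ : DecidableEquality B
    _≟B_ = finite-≟ finB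

    _≟C_ : DecidableEquality C
    _≟C_ = finite-≟ finC

    _≟D_ : DecidableEquality D
    _≟D_ = finite-≟ finD

    cover : ∀ d → d ∈Im h ⊎ d ∈Im k
    cover d with ∈Im? finB finD h d | ∈Im? finC finD k d
    ... | yes d∈h | _       = inj₁ d∈h
    ... | no _    | yes d∈k = inj₂ d∈k
    -- The indicator of `d` and the constant `false` agree on the images of `h` and `k`, so `unique`
    -- would make them agree at `d`.
    ... | no d∉h  | no d∉k  = contradiction
      (trans (sym (dec-true (d ≟D d) refl))
        (unique (λ d′ → does (d′ ≟D d)) (const false)
          (λ b → dec-false (h b ≟D d) (λ eq → d∉h (b , eq)))
          (λ c → dec-false (k c ≟D d) (λ eq → d∉k (c , eq))) d))
      true≢false

    -- Completes a colouring of `C` to a compatible pair. On the image of `f` the compatibility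
    -- forces the value, and injectivity of `f` makes it independent of the preimage found;
    -- elsewhere `false` is an arbitrary choice.
    extend : (C → Bool) → B → Bool
    extend γ b with ∈Im? finA finB f b
    ... | yes (a , _) = γ (g a)
    ... | no  _       = false

    extend-f : ∀ γ a → extend γ (f a) ≡ γ (g a)
    extend-f γ a with ∈Im? finA finB f (f a)
    ... | yes (_ , fa₁≡fa) = cong (γ ∘ g) (f-inj fa₁≡fa)
    ... | no  fa∉f         = contradiction (a , refl) fa∉f

    k-inj : Inj k
    k-inj {c} {c′} kc≡kc′ with c ≟C c′
    ... | yes c≡c′ = c≡c′
    -- The indicator of `c′`, extended to `B`, glues to a colouring of `D` that separates `k c` from
    -- `k c′`.
    ... | no  c≢c′ = contradiction
      (trans (sym (dec-true (c′ ≟C c′) refl))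
        (trans (sym (δ-k c′)) (trans (cong δ (sym kc≡kc′)) (trans (δ-k c) (dec-false (c ≟C c′) c≢c′)))))
      true≢false
      where
      γ : C → Bool
      γ x = does (x ≟C c′)
      glued = glue (extend γ) γ (extend-f γ)
      δ   = proj₁ glued
      δ-k = proj₂ (proj₂ glued)

    meet : ∀ {b c} → h b ≡ k c → ∃ λ a → f a ≡ b × g a ≡ c
    meet {b} {c} hb≡kc with ∈Im? finA finB f b
    ... | yes (a , refl) = a , refl , k-inj (trans (sym (commutes a)) hb≡kc)
    -- The indicator of `b` vanishes on the image of `f`, so it glues with the constant `false` on
    -- `C`; the result is true at `h b` and false at `k c`.
    ... | no  b∉f        = contradiction
      (trans (sym (dec-true (b ≟B b) refl))
        (trans (sym (δ-h b)) (trans (cong δ hb≡kc) (δ-k c))))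
      true≢false
      where
      glued = glue (λ x → does (x ≟B b)) (const false)
                (λ a → dec-false (f a ≟B b) (λ eq → b∉f (a , eq)))
      δ   = proj₁ glued
      δ-h = proj₁ (proj₂ glued)
      δ-k = proj₂ (proj₂ glued)

  colourPushout⇒gluing : Gluing f g h k
  colourPushout⇒gluing = record
    { commutes = commutes ; f-inj = f-inj ; h-inj = h-inj
    ; k-inj = k-inj ; cover = cover ; meet = meet }

-- Morphisms

idᴳ : {G : Graph 𝓛} → G ⟶ G
idᴳ = record
  { fV     = id
  ; fE     = id
  ; pres-s = λ _ → refl
  ; pres-t = λ _ → refl
  ; pres-m = λ _ → refl
  ; pres-l = λ _ eq → eq
  ; pres-p = λ _ eq → eq
  }

≈-sym : {G H : Graph 𝓛} {f g : G ⟶ H} → f ≈ g → g ≈ f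
≈-sym (eqV , eqE) = (sym ∘ eqV) , (sym ∘ eqE)

≈-trans : {G H : Graph 𝓛} {f g h : G ⟶ H} → f ≈ g → g ≈ h → f ≈ h
≈-trans (eqV , eqE) (eqV′ , eqE′) =
  (λ v → trans (eqV v) (eqV′ v)) , (λ e → trans (eqE e) (eqE′ e))

∘-congˡ : {G H J : Graph 𝓛} {f g : G ⟶ H} (h : H ⟶ J) → f ≈ g → h ∘ᴳ f ≈ h ∘ᴳ g
∘-congˡ h (eqV , eqE) = (cong (fV h) ∘ eqV) , (cong (fE h) ∘ eqE)

≅-fromInverses : {G H : Graph 𝓛} (u : G ⟶ H) (w : H ⟶ G) →
                 u ∘ᴳ w ≈ idᴳ → w ∘ᴳ u ≈ idᴳ → G ≅ H
≅-fromInverses u w (uwV , uwE) (wuV , wuE) = record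
  { to       = u
  ; from     = w
  ; inverseV = (λ { refl → uwV _ }) , (λ { refl → wuV _ })
  ; inverseE = (λ { refl → uwE _ }) , (λ { refl → wuE _ })
  }

IsTLRG-≅ : {G H : Graph 𝓛} → G ≅ H → IsTLRG G ⇔ IsTLRG H
IsTLRG-≅ {𝓛} {G} {H} i = mk⇔
  (λ (l-total , p-total) → total to from uw l-total (pres-l to) , total to from uw p-total (pres-p to))
  (λ (l-total , p-total) → total from to wu l-total (pres-l from) , total from to wu p-total (pres-p from))
  where
  open _≅_ i
  uw : ∀ v → fV to (fV from v) ≡ v
  uw _ = proj₁ inverseV refl
  wu : ∀ v → fV from (fV to v) ≡ v
  wu _ = proj₂ inverseV refl
  total : {M N : Graph 𝓛} (u : M ⟶ N) (w : N ⟶ M) → (∀ v → fV u (fV w v) ≡ v) →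
          {aM : V M → Maybe X} {aN : V N → Maybe X} →
          (∀ v → Is-just (aM v)) → Preserves (fV u) aM aN → ∀ v → Is-just (aN v)
  -- Since `u` inverts `w`, the node `v` is the image of `fV w v`, whose defined attribute `u`
  -- preserves.
  total u w uw′ {aM} {aN} tot pres v with aM (fV w v) in eq | tot (fV w v)
  ... | just _ | _ =
    subst Is-just (trans (sym (pres (fV w v) eq)) (cong aN (uw′ v))) (just tt)

-- Gluings of graphs are natural pushouts

record GraphGluing {A B C D : Graph 𝓛} (f : A ⟶ B) (g : A ⟶ C) (h : B ⟶ D) (k : C ⟶ D) : Set where
  field
    onV : Gluing (fV f) (fV g) (fV h) (fV k)
    onE : Gluing (fE f) (fE g) (fE h) (fE k)
    onL : AttrGluing (fV f) (fV g) (fV h) (fV k) (l A) (l B) (l C) (l D)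
    onP : AttrGluing (fV f) (fV g) (fV h) (fV k) (p A) (p B) (p C) (p D)

  commutesᴳ : h ∘ᴳ f ≈ k ∘ᴳ g
  commutesᴳ = Gluing.commutes onV , Gluing.commutes onE

module _ {A B C D : Graph 𝓛} {f : A ⟶ B} {g : A ⟶ C} {h : B ⟶ D} {k : C ⟶ D}
         (gl : GraphGluing f g h k) where
  open GraphGluing gl
  private
    module GV = Gluing onV
    module GE = Gluing onE

  -- Copairing is done on nodes and edges separately. `cover` reduces endpoints, marks and
  -- uniqueness to elements coming from `B` or `C`, and `support` does the same for each label.
  gluing⇒pushout : IsPushout f g h k
  gluing⇒pushout = record { commutes = commutesᴳ ; universal = universal }
    where
    universal : ∀ {X} (h′ : B ⟶ X) (k′ : C ⟶ X) → h′ ∘ᴳ f ≈ k′ ∘ᴳ g → _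
    universal {X} h′ k′ (agreeV , agreeE) =
      u , ((CV.copair-h , CE.copair-h) , (CV.copair-k , CE.copair-k)) ,
      λ {w} → u-unique {w}
      where
      module CV = Copairing onV (fV h′) (fV k′) agreeV
      module CE = Copairing onE (fE h′) (fE k′) agreeE

      -- The endpoint functions are parameters so that source and target share one argument.
      pres-end : (eB : E B → V B) (eC : E C → V C) (eD : E D → V D) (eX : E X → V X) →
                 (∀ e → fV h (eB e) ≡ eD (fE h e)) → (∀ e → fV k (eC e) ≡ eD (fE k e)) →
                 (∀ e → fV h′ (eB e) ≡ eX (fE h′ e)) → (∀ e → fV k′ (eC e) ≡ eX (fE k′ e)) →
                 ∀ e → CV.copair (eD e) ≡ eX (CE.copair e)
      pres-end eB eC eD eX hE kE h′E k′E e with GE.cover e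
      ... | inj₁ (b , refl) = trans (cong CV.copair (sym (hE b))) (trans (CV.copair-h (eB b)) (h′E b))
      ... | inj₂ (c , refl) = trans (cong CV.copair (sym (kE c))) (trans (CV.copair-k (eC c)) (k′E c))

      pres-attr : {aA : V A → Maybe Y} {aB : V B → Maybe Y} {aC : V C → Maybe Y}
                  {aD : V D → Maybe Y} (aX : V X → Maybe Y) →
                  AttrGluing (fV f) (fV g) (fV h) (fV k) aA aB aC aD →
                  Preserves (fV h′) aB aX → Preserves (fV k′) aC aX → Preserves CV.copair aD aX
      pres-attr aX ag h′-pres k′-pres d aDd≡ with AttrGluing.support ag d aDd≡
      ... | inj₁ (b , refl , aBb≡) = trans (cong aX (CV.copair-h b)) (h′-pres b aBb≡)
      ... | inj₂ (c , refl , aCc≡) = trans (cong aX (CV.copair-k c)) (k′-pres c aCc≡)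

      pres-mark : ∀ e → m X (CE.copair e) ≡ m D e
      pres-mark e with GE.cover e
      ... | inj₁ (b , refl) = trans (pres-m h′ b) (sym (pres-m h b))
      ... | inj₂ (c , refl) = trans (pres-m k′ c) (sym (pres-m k c))

      u : D ⟶ X
      u = record
        { fV     = CV.copair
        ; fE     = CE.copair
        ; pres-s = pres-end (s B) (s C) (s D) (s X) (pres-s h) (pres-s k) (pres-s h′) (pres-s k′)
        ; pres-t = pres-end (t B) (t C) (t D) (t X) (pres-t h) (pres-t k) (pres-t h′) (pres-t k′)
        ; pres-m = pres-mark
        ; pres-l = pres-attr (l X) onL (pres-l h′) (pres-l k′)
        ; pres-p = pres-attr (p X) onP (pres-p h′) (pres-p k′)
        }

      u-unique : {w : D ⟶ X} → (w ∘ᴳ h ≈ h′) × (w ∘ᴳ k ≈ k′) → u ≈ w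
      u-unique {w} ((whV , whE) , (wkV , wkE)) = onNodes , onEdges
        where
        onNodes : ∀ v → CV.copair v ≡ fV w v
        onNodes v with GV.cover v
        ... | inj₁ (b , refl) = sym (whV b)
        ... | inj₂ (c , refl) = sym (wkV c)
        onEdges : ∀ e → CE.copair e ≡ fE w e
        onEdges e with GE.cover e
        ... | inj₁ (b , refl) = sym (whE b)
        ... | inj₂ (c , refl) = sym (wkE c)

  -- `meet` supplies the values of the mediating map, injectivity of `f` its uniqueness and its
  -- compatibility with endpoints, and `reflect` its preservation of labels.
  gluing⇒pullback : IsPullback f g h k
  gluing⇒pullback = record { commutes = commutesᴳ ; universal = universal }
    where
    universal : ∀ {X} (f′ : X ⟶ B) (g′ : X ⟶ C) → h ∘ᴳ f′ ≈ k ∘ᴳ g′ → _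
    universal {X} f′ g′ (agreeV , agreeE) =
      u , ((fuV , fuE) , (guV , guE)) ,
      λ ((fwV , fwE) , _) → (λ v → GV.f-inj (trans (fuV v) (sym (fwV v)))) ,
                            (λ e → GE.f-inj (trans (fuE e) (sym (fwE e))))
      where
      uV : V X → V A
      uV v = proj₁ (GV.meet (agreeV v))
      fuV : ∀ v → fV f (uV v) ≡ fV f′ v
      fuV v = proj₁ (proj₂ (GV.meet (agreeV v)))
      guV : ∀ v → fV g (uV v) ≡ fV g′ v
      guV v = proj₂ (proj₂ (GV.meet (agreeV v)))
      uE : E X → E A
      uE e = proj₁ (GE.meet (agreeE e))
      fuE : ∀ e → fE f (uE e) ≡ fE f′ e
      fuE e = proj₁ (proj₂ (GE.meet (agreeE e)))
      guE : ∀ e → fE g (uE e) ≡ fE g′ e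
      guE e = proj₂ (proj₂ (GE.meet (agreeE e)))

      pres-end : (eX : E X → V X) (eA : E A → V A) (eB : E B → V B) →
                 (∀ e → fV f (eA e) ≡ eB (fE f e)) → (∀ e → fV f′ (eX e) ≡ eB (fE f′ e)) →
                 ∀ e → uV (eX e) ≡ eA (uE e)
      pres-end eX eA eB f-end f′-end e = GV.f-inj
        (trans (fuV (eX e)) (trans (f′-end e) (trans (cong eB (sym (fuE e))) (sym (f-end (uE e))))))

      pres-attr : {aA : V A → Maybe Y} {aB : V B → Maybe Y} {aC : V C → Maybe Y}
                  {aD : V D → Maybe Y} {aX : V X → Maybe Y} →
                  AttrGluing (fV f) (fV g) (fV h) (fV k) aA aB aC aD →
                  Preserves (fV f′) aX aB → Preserves (fV g′) aX aC → Preserves uV aX aA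
      pres-attr {aB = aB} {aC} ag f′-pres g′-pres v aXv≡ = AttrGluing.reflect ag (uV v)
        (trans (cong aB (fuV v)) (f′-pres v aXv≡)) (trans (cong aC (guV v)) (g′-pres v aXv≡))

      u : X ⟶ A
      u = record
        { fV     = uV
        ; fE     = uE
        ; pres-s = pres-end (s X) (s A) (s B) (pres-s f) (pres-s f′)
        ; pres-t = pres-end (t X) (t A) (t B) (pres-t f) (pres-t f′)
        ; pres-m = λ e → trans (sym (pres-m f (uE e))) (trans (cong (m B) (fuE e)) (pres-m f′ e))
        ; pres-l = pres-attr onL (pres-l f′) (pres-l g′)
        ; pres-p = pres-attr onP (pres-p f′) (pres-p g′)
        }

  gluing⇒naturalPushout : IsNaturalPushout f g h k
  gluing⇒naturalPushout = gluing⇒pushout , gluing⇒pullback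

-- Natural pushouts of injections are gluings

-- Both `u` and `w` mediate the cocone obtained by composing `w` with `h` and `k`, so both equal the
-- mediator `c`.
pushout-epi : {A B C D X : Graph 𝓛} {f : A ⟶ B} {g : A ⟶ C} {h : B ⟶ D} {k : C ⟶ D} →
              IsPushout f g h k → (u w : D ⟶ X) →
              u ∘ᴳ h ≈ w ∘ᴳ h → u ∘ᴳ k ≈ w ∘ᴳ k → u ≈ w
pushout-epi {f = f} {g} {h} {k} po u w uh≈wh uk≈wk =
  ≈-trans {f = u} {c} {w} (≈-sym {f = c} {u} (c-unique {u} (uh≈wh , uk≈wk)))
          (c-unique {w} (((λ _ → refl) , (λ _ → refl)) , ((λ _ → refl) , (λ _ → refl))))
  where
  open IsPushout po
  med = universal (w ∘ᴳ h) (w ∘ᴳ k) (∘-congˡ {f = h ∘ᴳ f} {g = k ∘ᴳ g} w commutes)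
  c = proj₁ med
  c-unique : ∀ {y} → _ → c ≈ y
  c-unique {y} = proj₂ (proj₂ med) {y}

-- Up to labels, the product of `G` with the graph that has two nodes and two parallel edges from
-- each node to each node. An edge records its own colour and those of its endpoints, so arbitrary
-- independent colourings of nodes and of edges become morphisms. The factor `G` supplies the labels
-- and marks that morphisms must preserve.
Coloured : Graph 𝓛 → Graph 𝓛
Coloured G = record
  { V        = Bool × V G
  ; E        = (Bool × Bool × Bool) × E G
  ; finite-V = finite-× finite-Bool (finite-V G)
  ; finite-E = finite-× (finite-× finite-Bool (finite-× finite-Bool finite-Bool)) (finite-E G)
  ; s        = λ ((_ , i , _) , e) → i , s G e
  ; t        = λ ((_ , _ , j) , e) → j , t G e
  ; l        = l G ∘ proj₂
  ; m        = m G ∘ proj₂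
  ; p        = p G ∘ proj₂
  }

colour : {B D : Graph 𝓛} → B ⟶ D → (V B → Bool) → (E B → Bool) → B ⟶ Coloured D
colour {B = B} f χ ξ = record
  { fV     = λ v → χ v , fV f v
  ; fE     = λ e → (ξ e , χ (s B e) , χ (t B e)) , fE f e
  ; pres-s = λ e → cong (χ (s B e) ,_) (pres-s f e)
  ; pres-t = λ e → cong (χ (t B e) ,_) (pres-t f e)
  ; pres-m = pres-m f
  ; pres-l = pres-l f
  ; pres-p = pres-p f
  }

colour-square : {A B C D : Graph 𝓛} (f : A ⟶ B) (g : A ⟶ C) (h : B ⟶ D) (k : C ⟶ D) →
                h ∘ᴳ f ≈ k ∘ᴳ g →
                (χ : V B → Bool) (ξ : E B → Bool) (χ′ : V C → Bool) (ξ′ : E C → Bool) →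
                (∀ v → χ (fV f v) ≡ χ′ (fV g v)) → (∀ e → ξ (fE f e) ≡ ξ′ (fE g e)) →
                colour h χ ξ ∘ᴳ f ≈ colour k χ′ ξ′ ∘ᴳ g
colour-square {A = A} {B} {C} f g h k (eqV , eqE) χ ξ χ′ ξ′ χ≗ ξ≗ =
  (λ v → cong₂ _,_ (χ≗ v) (eqV v)) ,
  (λ e → cong₂ _,_ (cong₂ _,_ (ξ≗ e)
    (cong₂ _,_ (χ-end (s A) (s B) (s C) (pres-s f) (pres-s g) e)
               (χ-end (t A) (t B) (t C) (pres-t f) (pres-t g) e))) (eqE e))
  where
  χ-end : (eA : E A → V A) (eB : E B → V B) (eC : E C → V C) →
          (∀ e → fV f (eA e) ≡ eB (fE f e)) → (∀ e → fV g (eA e) ≡ eC (fE g e)) →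
          ∀ e → χ (eB (fE f e)) ≡ χ′ (eC (fE g e))
  χ-end eA eB eC f-end g-end e =
    trans (cong χ (sym (f-end e))) (trans (χ≗ (eA e)) (cong χ′ (g-end e)))

module _ {A B C D : Graph 𝓛} {f : A ⟶ B} {g : A ⟶ C} {h : B ⟶ D} {k : C ⟶ D}
         (po : IsPushout f g h k) where
  open IsPushout po

  private
    glued : (β : V B → Bool) (β′ : E B → Bool) (γ : V C → Bool) (γ′ : E C → Bool) →
            (∀ v → β (fV f v) ≡ γ (fV g v)) → (∀ e → β′ (fE f e) ≡ γ′ (fE g e)) → _
    glued β β′ γ γ′ agreeV agreeE = universal (colour h β β′) (colour k γ γ′)
      (colour-square f g h k commutes β β′ γ γ′ agreeV agreeE)

    -- A colouring of `D` is itself a morphism from `D` into `Coloured D` lying over the identity,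
    -- so `pushout-epi` applies to it.
    distinguished : (δ δ′ : V D → Bool) (ε ε′ : E D → Bool) →
                    (∀ v → δ (fV h v) ≡ δ′ (fV h v)) → (∀ e → ε (fE h e) ≡ ε′ (fE h e)) →
                    (∀ v → δ (fV k v) ≡ δ′ (fV k v)) → (∀ e → ε (fE k e) ≡ ε′ (fE k e)) →
                    colour (idᴳ {G = D}) δ ε ≈ colour idᴳ δ′ ε′
    distinguished δ δ′ ε ε′ hV hE kV kE = pushout-epi po (colour idᴳ δ ε) (colour idᴳ δ′ ε′)
      (colour-square h h idᴳ idᴳ ((λ _ → refl) , (λ _ → refl)) δ ε δ′ ε′ hV hE)
      (colour-square k k idᴳ idᴳ ((λ _ → refl) , (λ _ → refl)) δ ε δ′ ε′ kV kE)

  pushout⇒colourPushoutV : ColourPushout (fV f) (fV g) (fV h) (fV k)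
  pushout⇒colourPushoutV = record
    { glue   = λ β γ agree →
        let (u , ((uh , _) , (uk , _)) , _) =
              glued β (const false) γ (const false) agree (λ _ → refl)
        in proj₁ ∘ fV u , (cong proj₁ ∘ uh) , (cong proj₁ ∘ uk)
    ; unique = λ δ δ′ eqh eqk d → cong proj₁ (proj₁
        (distinguished δ δ′ (const false) (const false) eqh (λ _ → refl) eqk (λ _ → refl)) d)
    }

  pushout⇒colourPushoutE : ColourPushout (fE f) (fE g) (fE h) (fE k)
  pushout⇒colourPushoutE = record
    { glue   = λ β γ agree →
        let (u , ((_ , uh) , (_ , uk)) , _) =
              glued (const false) β (const false) γ (λ _ → refl) agree
        in proj₁ ∘ proj₁ ∘ fE u , (cong (proj₁ ∘ proj₁) ∘ uh) , (cong (proj₁ ∘ proj₁) ∘ uk)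
    ; unique = λ δ δ′ eqh eqk d → cong (proj₁ ∘ proj₁) (proj₂
        (distinguished (const false) (const false) δ δ′ (λ _ → refl) eqh (λ _ → refl) eqk) d)
    }

-- Label support in pushouts.

module Prune (finB : Finite B) (finC : Finite C) (finD : Finite D) (_≟_ : DecidableEquality X)
             (h : B → D) (k : C → D)
             (aB : B → Maybe X) (aC : C → Maybe X) (aD : D → Maybe X) where

  -- Comparing `Maybe` values keeps this decidable. At an unlabelled `d` either outcome makes
  -- `prune d` undefined.
  Supported : D → Set
  Supported d = (∃ λ b → h b ≡ d × aB b ≡ aD d) ⊎ (∃ λ c → k c ≡ d × aC c ≡ aD d)

  supported? : Decidable Supported
  supported? d =
    finite-any? finB (λ b → finite-≟ finD (h b) d ×-dec ≡-decᵐ _≟_ (aB b) (aD d))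
    ⊎-dec
    finite-any? finC (λ c → finite-≟ finD (k c) d ×-dec ≡-decᵐ _≟_ (aC c) (aD d))

  prune : D → Maybe X
  prune d with supported? d
  ... | yes _ = aD d
  ... | no  _ = nothing

  prune⊆ : Preserves id prune aD
  prune⊆ d pd≡ with supported? d
  ... | yes _ = pd≡

  prune-supported : ∀ d {x} → prune d ≡ just x → Supported d
  prune-supported d pd≡ with supported? d
  ... | yes sup = sup

  prune-keeps : ∀ d → Supported d → prune d ≡ aD d
  prune-keeps d sup with supported? d
  ... | yes _    = refl
  ... | no  ¬sup = contradiction sup ¬sup

  prune-h : Preserves h aB aD → Preserves h aB prune
  prune-h pres b aBb≡ = trans
    (prune-keeps (h b) (inj₁ (b , refl , trans aBb≡ (sym (pres b aBb≡))))) (pres b aBb≡)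

  prune-k : Preserves k aC aD → Preserves k aC prune
  prune-k pres c aCc≡ = trans
    (prune-keeps (k c) (inj₂ (c , refl , trans aCc≡ (sym (pres c aCc≡))))) (pres c aCc≡)

  prune-keeps-all⇒support : Preserves id aD prune → ∀ d {x} → aD d ≡ just x →
    (∃ λ b → h b ≡ d × aB b ≡ just x) ⊎ (∃ λ c → k c ≡ d × aC c ≡ just x)
  prune-keeps-all⇒support keeps d aDd≡ with prune-supported d (keeps d aDd≡)
  ... | inj₁ (b , hb≡d , aBb≡) = inj₁ (b , hb≡d , trans aBb≡ aDd≡)
  ... | inj₂ (c , kc≡d , aCc≡) = inj₂ (c , kc≡d , trans aCc≡ aDd≡)

relabel : (G : Graph 𝓛) → (V G → Maybe (NodeLabel 𝓛)) → (V G → Maybe Bool) → Graph 𝓛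
relabel G l′ p′ = record
  { V = V G ; E = E G ; finite-V = finite-V G ; finite-E = finite-E G
  ; s = s G ; t = t G ; l = l′ ; m = m G ; p = p′ }

corestrict : {B D : Graph 𝓛} (f : B ⟶ D)
             {l′ : V D → Maybe (NodeLabel 𝓛)} {p′ : V D → Maybe Bool} →
             Preserves (fV f) (l B) l′ → Preserves (fV f) (p B) p′ → B ⟶ relabel D l′ p′
corestrict f pl pp = record
  { fV = fV f ; fE = fE f ; pres-s = pres-s f ; pres-t = pres-t f ; pres-m = pres-m f
  ; pres-l = pl ; pres-p = pp }

module _ {A B C D : Graph 𝓛} {f : A ⟶ B} {g : A ⟶ C} {h : B ⟶ D} {k : C ⟶ D}
         (po : IsPushout f g h k) where
  open IsPushout po
  private
    module PL = Prune (finite-V B) (finite-V C) (finite-V D) (finite-≟ (finite-NodeLabel 𝓛))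
                      (fV h) (fV k) (l B) (l C) (l D)
    module PP = Prune (finite-V B) (finite-V C) (finite-V D) _≟ᵇ_
                      (fV h) (fV k) (p B) (p C) (p D)

    D↓ : Graph 𝓛
    D↓ = relabel D PL.prune PP.prune

    ι : D↓ ⟶ D
    ι = record
      { fV = id ; fE = id ; pres-s = λ _ → refl ; pres-t = λ _ → refl ; pres-m = λ _ → refl
      ; pres-l = PL.prune⊆ ; pres-p = PP.prune⊆ }

    h↓ : B ⟶ D↓
    h↓ = corestrict h (PL.prune-h (pres-l h)) (PP.prune-h (pres-p h))

    k↓ : C ⟶ D↓
    k↓ = corestrict k (PL.prune-k (pres-l k)) (PP.prune-k (pres-p k))

    med = universal h↓ k↓ commutes

    u : D ⟶ D↓
    u = proj₁ med

    -- Followed by the inclusion `ι`, `u` is an endomorphism of `D` that fixes `h` and `k`, hence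
    -- the identity; and `ι` is the identity on nodes.
    u-id : ∀ v → fV u v ≡ v
    u-id = let (uh , uk) = proj₁ (proj₂ med) in proj₁ (pushout-epi po (ι ∘ᴳ u) idᴳ uh uk)

    keeps : {aD aD↓ : V D → Maybe X} → Preserves (fV u) aD aD↓ → Preserves id aD aD↓
    keeps {aD↓ = aD↓} pres v aDv≡ = trans (cong aD↓ (sym (u-id v))) (pres v aDv≡)

  -- `B` and `C` still map into the pruned graph, so the pushout property yields a morphism from `D`
  -- to it. That morphism is the identity on nodes and preserves labels, so pruning removed none.
  pushout-supports-l : ∀ v {x} → l D v ≡ just x →
    (∃ λ b → fV h b ≡ v × l B b ≡ just x) ⊎ (∃ λ c → fV k c ≡ v × l C c ≡ just x)
  pushout-supports-l = PL.prune-keeps-all⇒support (keeps {aD↓ = PL.prune} (pres-l u))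

  pushout-supports-p : ∀ v {x} → p D v ≡ just x →
    (∃ λ b → fV h b ≡ v × p B b ≡ just x) ⊎ (∃ λ c → fV k c ≡ v × p C c ≡ just x)
  pushout-supports-p = PP.prune-keeps-all⇒support (keeps {aD↓ = PP.prune} (pres-p u))

-- Label reflection in pullbacks.

point : Maybe (NodeLabel 𝓛) → Maybe Bool → Graph 𝓛
point a b = record
  { V = ⊤ ; E = ⊥ ; finite-V = finite-⊤ ; finite-E = finite-⊥
  ; s = λ () ; t = λ () ; l = const a ; m = λ () ; p = const b }

pointAt : {G : Graph 𝓛} {a : Maybe (NodeLabel 𝓛)} {b : Maybe Bool} (v : V G) →
          (∀ {x} → a ≡ just x → l G v ≡ just x) → (∀ {y} → b ≡ just y → p G v ≡ just y) →
          point a b ⟶ G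
pointAt v has-l has-p = record
  { fV = const v ; fE = λ () ; pres-s = λ () ; pres-t = λ () ; pres-m = λ ()
  ; pres-l = λ _ → has-l ; pres-p = λ _ → has-p }

module _ {A B C D : Graph 𝓛} {f : A ⟶ B} {g : A ⟶ C} {h : B ⟶ D} {k : C ⟶ D}
         (pb : IsPullback f g h k) (f-inj : Inj (fV f)) where
  open IsPullback pb

  -- A single node labelled `x` maps to `fV f v` and to `fV g v`. The induced morphism into `A` must
  -- hit `v`, as `f` is injective on nodes, and it preserves the label. Rootedness of the test node
  -- is left undefined so that it imposes nothing.
  pullback-reflects-l : ∀ v {x} → l B (fV f v) ≡ just x → l C (fV g v) ≡ just x → l A v ≡ just x
  pullback-reflects-l v {x} lB≡ lC≡ =
    let (u , ((fu , _) , _) , _) = universal {point (just x) nothing}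
          (pointAt (fV f v) (λ { refl → lB≡ }) λ ()) (pointAt (fV g v) (λ { refl → lC≡ }) λ ())
          ((λ _ → proj₁ commutes v) , λ ())
    in trans (cong (l A) (sym (f-inj (fu tt)))) (pres-l u tt refl)

  pullback-reflects-p : ∀ v {x} → p B (fV f v) ≡ just x → p C (fV g v) ≡ just x → p A v ≡ just x
  pullback-reflects-p v {x} pB≡ pC≡ =
    let (u , ((fu , _) , _) , _) = universal {point nothing (just x)}
          (pointAt (fV f v) (λ ()) λ { refl → pB≡ }) (pointAt (fV g v) (λ ()) λ { refl → pC≡ })
          ((λ _ → proj₁ commutes v) , λ ())
    in trans (cong (p A) (sym (f-inj (fu tt)))) (pres-p u tt refl)

-- The pushout half gives the set-level gluings and `support`; the pullback half gives `reflect`.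
naturalPushout⇒gluing :
  {A B C D : Graph 𝓛} {f : A ⟶ B} {g : A ⟶ C} {h : B ⟶ D} {k : C ⟶ D} →
  Injective f → Injective h → IsNaturalPushout f g h k → GraphGluing f g h k
naturalPushout⇒gluing {A = A} {B} {C} {D} (fV-inj , fE-inj) (hV-inj , hE-inj) (po , pb) = record
  { onV = colourPushout⇒gluing (finite-V A) (finite-V B) (finite-V C) (finite-V D)
            (proj₁ (IsPushout.commutes po)) fV-inj hV-inj (pushout⇒colourPushoutV po)
  ; onE = colourPushout⇒gluing (finite-E A) (finite-E B) (finite-E C) (finite-E D)
            (proj₂ (IsPushout.commutes po)) fE-inj hE-inj (pushout⇒colourPushoutE po)
  ; onL = record { support = pushout-supports-l po ; reflect = pullback-reflects-l pb fV-inj }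
  ; onP = record { support = pushout-supports-p po ; reflect = pullback-reflects-p pb fV-inj }
  }

-- Uniqueness

complement-map :
  {A B C C′ D : Graph 𝓛} {f : A ⟶ B} {h : B ⟶ D}
  {g : A ⟶ C} {k : C ⟶ D} {g′ : A ⟶ C′} {k′ : C′ ⟶ D} →
  GraphGluing f g h k → GraphGluing f g′ h k′ →
  ∃ λ (u : C ⟶ C′) → (k′ ∘ᴳ u ≈ k) × (u ∘ᴳ g ≈ g′)
complement-map {C = C} {C′} {D} {g = g} {k} {g′} {k′} gl gl′ =
  record
    { fV     = CV.lift
    ; fE     = CE.lift
    ; pres-s = pres-end (s C) (s C′) (s D) (pres-s k) (pres-s k′)
    ; pres-t = pres-end (t C) (t C′) (t D) (pres-t k) (pres-t k′)
    ; pres-m = λ e → trans (sym (pres-m k′ (CE.lift e)))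
                       (trans (cong (m D) (CE.k′-lift e)) (pres-m k e))
    ; pres-l = CV.lift-preserves (onL gl) (onL gl′) (pres-l k) (pres-l g′)
    ; pres-p = CV.lift-preserves (onP gl) (onP gl′) (pres-p k) (pres-p g′)
    } , (CV.k′-lift , CE.k′-lift) , (CV.lift-g , CE.lift-g)
  where
  open GraphGluing
  module CV = ComplementMap (onV gl) (onV gl′)
  module CE = ComplementMap (onE gl) (onE gl′)
  pres-end : (eC : E C → V C) (eC′ : E C′ → V C′) (eD : E D → V D) →
             (∀ e → fV k (eC e) ≡ eD (fE k e)) → (∀ e → fV k′ (eC′ e) ≡ eD (fE k′ e)) →
             ∀ e → CV.lift (eC e) ≡ eC′ (CE.lift e)
  -- Endpoints are compared after the injection `k′`, where both become the endpoint of `fE k e` in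
  -- `D`.
  pres-end eC eC′ eD k-end k′-end e = Gluing.k-inj (onV gl′)
    (trans (CV.k′-lift (eC e)) (trans (k-end e)
      (trans (cong eD (sym (CE.k′-lift e))) (sym (k′-end (CE.lift e))))))

mono-section : {C C′ D : Graph 𝓛} {k : C ⟶ D} {k′ : C′ ⟶ D} → Injective k →
               (u : C ⟶ C′) (w : C′ ⟶ C) → k′ ∘ᴳ u ≈ k → k ∘ᴳ w ≈ k′ → w ∘ᴳ u ≈ idᴳ
mono-section (kV-inj , kE-inj) u w (kuV , kuE) (kwV , kwE) =
  (λ v → kV-inj (trans (kwV (fV u v)) (kuV v))) ,
  (λ e → kE-inj (trans (kwE (fE u e)) (kuE e)))

pushout-map :
  {A B C C′ D D′ : Graph 𝓛} {f : A ⟶ B} {g : A ⟶ C} {h : B ⟶ D} {k : C ⟶ D}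
  {g′ : A ⟶ C′} {h′ : B ⟶ D′} {k′ : C′ ⟶ D′} →
  IsPushout f g h k → IsPushout f g′ h′ k′ → (u : C ⟶ C′) → u ∘ᴳ g ≈ g′ →
  ∃ λ (w : D ⟶ D′) → (w ∘ᴳ h ≈ h′) × (w ∘ᴳ k ≈ k′ ∘ᴳ u)
pushout-map {f = f} {g} {h} {k} {g′} {h′} {k′} po po′ u ug≈g′ =
  let (w , wh≈ , _) = IsPushout.universal po h′ (k′ ∘ᴳ u)
        (≈-trans {f = h′ ∘ᴳ f} {k′ ∘ᴳ g′} {k′ ∘ᴳ (u ∘ᴳ g)} (IsPushout.commutes po′)
          (≈-sym {f = k′ ∘ᴳ (u ∘ᴳ g)} {k′ ∘ᴳ g′} (∘-congˡ {f = u ∘ᴳ g} {g′} k′ ug≈g′)))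
  in w , wh≈

-- By `pushout-epi` it suffices to compare on `B`, where the maps cancel directly, and on `C`, where
-- the claim reduces to `u′` undoing `u`.
pushout-section :
  {A B C C′ D D′ : Graph 𝓛} {f : A ⟶ B} {g : A ⟶ C} {h : B ⟶ D} {k : C ⟶ D}
  {h′ : B ⟶ D′} {k′ : C′ ⟶ D′} →
  IsPushout f g h k → (u : C ⟶ C′) (u′ : C′ ⟶ C) → u′ ∘ᴳ u ≈ idᴳ →
  (w : D ⟶ D′) (w′ : D′ ⟶ D) → w ∘ᴳ h ≈ h′ → w ∘ᴳ k ≈ k′ ∘ᴳ u →
  w′ ∘ᴳ h′ ≈ h → w′ ∘ᴳ k′ ≈ k ∘ᴳ u′ → w′ ∘ᴳ w ≈ idᴳ
pushout-section {k = k} po u u′ (uuV , uuE) w w′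
  (whV , whE) (wkV , wkE) (w′hV , w′hE) (w′kV , w′kE) =
  pushout-epi po (w′ ∘ᴳ w) idᴳ
    ((λ v → trans (cong (fV w′) (whV v)) (w′hV v)) ,
     (λ e → trans (cong (fE w′) (whE e)) (w′hE e)))
    ((λ v → trans (cong (fV w′) (wkV v)) (trans (w′kV (fV u v)) (cong (fV k) (uuV v)))) ,
     (λ e → trans (cong (fE w′) (wkE e)) (trans (w′kE (fE u e)) (cong (fE k) (uuE e)))))

module _ (r : Rule 𝓛) {G : Graph 𝓛} (g : L r ⟶ G) (g-inj : Injective g) where

  left-gluing : (N : NaturalDoublePushout r g) → let open NaturalDoublePushout N in
                GraphGluing (inL r) K⟶D g D⟶G
  left-gluing N = naturalPushout⇒gluing (inL-inj r) g-inj (NaturalDoublePushout.left N)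

  -- The left squares are gluings, which determine `D` as the complement of `L` in `G` over `K`. The
  -- isomorphism is compatible with the maps from `K`, so it extends to the pushouts on the right.
  naturalDoublePushout-unique : (N N′ : NaturalDoublePushout r g) →
    (NaturalDoublePushout.D N ≅ NaturalDoublePushout.D N′) ×
    (NaturalDoublePushout.H N ≅ NaturalDoublePushout.H N′)
  naturalDoublePushout-unique N N′ =
    let (u  , ku  , ug)  = complement-map gl gl′
        (u′ , ku′ , ug′) = complement-map gl′ gl
        uu′ = mono-section {k = M′.D⟶G} {M.D⟶G} (mono gl′) u′ u ku′ ku
        u′u = mono-section {k = M.D⟶G} {M′.D⟶G} (mono gl) u u′ ku ku′
        po  = proj₁ M.right
        po′ = proj₁ M′.right
        (w  , wh  , wk)  = pushout-map po po′ u ug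
        (w′ , wh′ , wk′) = pushout-map po′ po u′ ug′
    in ≅-fromInverses u u′ uu′ u′u ,
       ≅-fromInverses w w′
         (pushout-section {h′ = M.R⟶H} {M.D⟶H} po′ u′ u uu′ w′ w wh′ wk′ wh wk)
         (pushout-section {h′ = M′.R⟶H} {M′.D⟶H} po u u′ u′u w w′ wh wk wh′ wk′)
    where
    module M  = NaturalDoublePushout N
    module M′ = NaturalDoublePushout N′
    gl  = left-gluing N
    gl′ = left-gluing N′
    mono : ∀ {C : Graph 𝓛} {f : K r ⟶ C} {k : C ⟶ G} → GraphGluing (inL r) f g k → Injective k
    mono x = Gluing.k-inj (GraphGluing.onV x) , Gluing.k-inj (GraphGluing.onE x)

  -- An edge outside the image of `g` comes from `D` by `cover`, hence so do its endpoints. An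
  -- endpoint that also lies in the image of `g` comes from `K` by `meet`.
  naturalDoublePushout⇒dangling : NaturalDoublePushout r g → Dangling r g
  naturalDoublePushout⇒dangling N e e∉g v v∉K with Gluing.cover (GraphGluing.onE (left-gluing N)) e
  ... | inj₁ e∈g         = contradiction e∈g e∉g
  ... | inj₂ (e′ , refl) = [ apart (pres-s D⟶G e′) , apart (pres-t D⟶G e′) ]′
    where
    open NaturalDoublePushout N
    apart : ∀ {x y} → fV D⟶G x ≡ y → ¬ (y ≡ fV g v)
    apart kx≡y y≡gv = let (a , fa≡v , _) = Gluing.meet (GraphGluing.onV (left-gluing N))
                                             (sym (trans kx≡y y≡gv))
                      in v∉K (a , fa≡v)

-- Rule application yields gluings

-- A kept element of `D` is either outside the image of `h` or the image of an element of `A`. This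
-- gives the left square on nodes and on edges alike.
complement-gluing :
  (finA : Finite A) (finB : Finite B) (finD : Finite D) {f : A → B} {h : B → D} →
  Inj f → Inj h →
  let Kept = λ d → ¬ ∃ λ b → ¬ (b ∈Im f) × h b ≡ d in
  Decidable (λ d → ∃ λ b → ¬ (b ∈Im f) × h b ≡ d) →
  (kept : ∀ a → Kept (h (f a))) →
  Gluing f (λ a → _,_ {P = Kept} (h (f a)) [ kept a ]) h value
complement-gluing finA finB finD {f} {h} f-inj h-inj deleted? kept = record
  { commutes = λ _ → refl
  ; f-inj    = f-inj
  ; h-inj    = h-inj
  ; k-inj    = value-injective
  ; cover    = cover
  ; meet     = meet
  }
  where
  cover : ∀ d → d ∈Im h ⊎ d ∈Im value
  cover d with deleted? d
  ... | yes (b , _ , hb≡d) = inj₁ (b , hb≡d)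
  ... | no  ¬deleted       = inj₂ ((d , [ ¬deleted ]) , refl)
  meet : ∀ {b c} → h b ≡ value c → ∃ λ a → f a ≡ b × (h (f a) , [ kept a ]) ≡ c
  -- The proof that `c` is kept is irrelevant and yields no preimage. The preimage is found by
  -- search, and the proof only refutes its absence.
  meet {b} {c , [ ¬deleted ]} hb≡c with ∈Im? finA finB f b
  ... | yes (a , refl) = a , refl , value-injective hb≡c
  ... | no  b∉f        = contradiction-irr ¬deleted (λ ¬del → ¬del (b , b∉f , hb≡c))

-- `h` enters only through its values on old and new elements, which lets one argument serve
-- `attach` and `attachE`.
adjunction-gluing :
  (finA : Finite A) (finB : Finite B) {f : A → B} {g : A → C} → Inj f → Inj g →
  let New = [ b ∈ B ∣ ¬ (b ∈Im f) ] in (h : B → C ⊎ New) →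
  (∀ a → h (f a) ≡ inj₁ (g a)) →
  (∀ (b : New) → h (value b) ≡ inj₂ b) →
  Gluing f g h inj₁
adjunction-gluing finA finB {f} {g} f-inj g-inj h h-old h-new = record
  { commutes = h-old
  ; f-inj    = f-inj
  ; h-inj    = h-inj
  ; k-inj    = inj₁-injective
  ; cover    = cover
  ; meet     = meet
  }
  where
  cover : ∀ d → d ∈Im h ⊎ d ∈Im inj₁
  cover (inj₁ c) = inj₂ (c , refl)
  cover (inj₂ b) = inj₁ (value b , h-new b)
  meet : ∀ {b c} → h b ≡ inj₁ c → ∃ λ a → f a ≡ b × g a ≡ c
  meet {b} hb≡ with ∈Im? finA finB f b
  ... | yes (a , refl) = a , refl , inj₁-injective (trans (sym (h-old a)) hb≡)
  ... | no  b∉f with () ← trans (sym hb≡) (h-new (b , [ b∉f ]))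
  h-inj : Inj h
  h-inj {b} {b′} hb≡hb′ with ∈Im? finA finB f b | ∈Im? finA finB f b′
  -- If one element is old, their common image lies in `C`, so `meet` makes the other old too and
  -- injectivity of `g` compares their preimages.
  ... | yes (a , refl) | _ with meet {b′} (trans (sym hb≡hb′) (h-old a))
  ...   | a′ , refl , ga′≡ga = cong f (sym (g-inj ga′≡ga))
  h-inj {b} {b′} hb≡hb′ | no _ | yes (a , refl) with meet {b} (trans hb≡hb′ (h-old a))
  ...   | a′ , refl , ga′≡ga = cong f (g-inj ga′≡ga)
  h-inj {b} {b′} hb≡hb′ | no b∉f | no b′∉f
    with refl ← trans (sym (h-new (b , [ b∉f ]))) (trans hb≡hb′ (h-new (b′ , [ b′∉f ]))) = refl

just-or-nothing : (x : Maybe A) → x ≡ nothing ⊎ ∃ λ a → x ≡ just a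
just-or-nothing nothing  = inj₁ refl
just-or-nothing (just a) = inj₂ (a , refl)

Is-just⇒≡just : {x : Maybe A} → Is-just x → ∃ λ a → x ≡ just a
Is-just⇒≡just {x = just a} _ = a , refl

nothing≢just : {x : A} → ¬ (nothing ≡ just x)
nothing≢just ()

-- The double pushout of a rule application.

module RuleApplication (r : Rule 𝓛) {G : Graph 𝓛} (g : L r ⟶ G)
                       (g-inj : Injective g) (dangling : Dangling r g) where
  open Application r g g-inj dangling hiding (intermediate; result)

  private
    Dᴵ Hᴿ : Graph 𝓛
    Dᴵ = intermediate r g g-inj dangling
    Hᴿ = result r g g-inj dangling

    gK-inj : Inj gK
    gK-inj = proj₁ (inL-inj r) ∘ proj₁ g-inj

  κV : V (K r) → VD
  κV k = gK k , [ gK-kept k ]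

  κE : E (K r) → ED
  κE e = fE g (fE (inL r) e) ,
         [ (λ (d , d∉K , gd≡) → d∉K (e , sym (proj₂ g-inj gd≡))) ]

  attach-old : ∀ k → attach (fV (inR r) k) ≡ inj₁ (κV k)
  attach-old k with ∈VK? (fV (inR r) k)
  ... | yes (_ , eq) = cong (inj₁ ∘ κV) (proj₁ (inR-inj r) eq)
  ... | no  ∉K       = contradiction (k , refl) ∉K

  attach-new : ∀ (v : VR∖K) → attach (value v) ≡ inj₂ v
  attach-new (v , [ v∉K ]) with ∈VK? v
  ... | yes v∈K = contradiction-irr v∉K (λ ∉K → ∉K v∈K)
  ... | no  _   = refl

  attachE : E (R r) → EH
  attachE e with ∈EK? e
  ... | yes (k , _) = inj₁ (κE k)
  ... | no  e∉K     = inj₂ (e , [ e∉K ])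

  attachE-old : ∀ k → attachE (fE (inR r) k) ≡ inj₁ (κE k)
  attachE-old k with ∈EK? (fE (inR r) k)
  ... | yes (_ , eq) = cong (inj₁ ∘ κE) (proj₂ (inR-inj r) eq)
  ... | no  ∉K       = contradiction (k , refl) ∉K

  attachE-new : ∀ (e : ER∖K) → attachE (value e) ≡ inj₂ e
  attachE-new (e , [ e∉K ]) with ∈EK? e
  ... | yes e∈K = contradiction-irr e∉K (λ ∉K → ∉K e∈K)
  ... | no  _   = refl

  module Attr {X : Set} (aK : V (K r) → Maybe X) (aL : V (L r) → Maybe X)
              (aR : V (R r) → Maybe X) (aG : V G → Maybe X)
              (L-total : ∀ v → Is-just (aL v)) (R-total : ∀ v → Is-just (aR v))
              (inL-pres : Preserves (fV (inL r)) aK aL) (inR-pres : Preserves (fV (inR r)) aK aR)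
              (g-pres : Preserves (fV g) aL aG) where

    aD : VD → Maybe X
    aD = attrD aK aG

    aH : VH → Maybe X
    aH = attrH aK aG aR

    aD-cleared : ∀ x → Cleared aK (value x) → aD x ≡ nothing
    aD-cleared (v , _) cl with cleared? aK v
    ... | yes _  = refl
    ... | no ¬cl = contradiction cl ¬cl

    aD-uncleared : ∀ x → ¬ Cleared aK (value x) → aD x ≡ aG (value x)
    aD-uncleared (v , _) ¬cl with cleared? aK v
    ... | yes cl = contradiction cl ¬cl
    ... | no _   = refl

    aH-cleared : ∀ k → aK k ≡ nothing → aH (inj₁ (κV k)) ≡ aR (fV (inR r) k)
    aH-cleared k aKk≡ with cleared? aK (gK k)
    -- The search may return an interface node other than the given one; injectivity of `gK`
    -- identifies the two.
    ... | yes (k′ , _ , gKk′≡) = cong (aR ∘ fV (inR r)) (gK-inj gKk′≡)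
    ... | no ¬cl               = contradiction (k , aKk≡ , refl) ¬cl

    aH-uncleared : ∀ x → ¬ Cleared aK (value x) → aH (inj₁ x) ≡ aG (value x)
    aH-uncleared x ¬cl with cleared? aK (value x)
    ... | yes cl = contradiction cl ¬cl
    ... | no _   = aD-uncleared x ¬cl

    just⇒uncleared : ∀ k {x} → aK k ≡ just x → ¬ Cleared aK (gK k)
    just⇒uncleared k aKk≡ (k′ , aKk′≡ , gKk′≡) = nothing≢just
      (trans (sym aKk′≡) (trans (cong aK (gK-inj gKk′≡)) aKk≡))

    gK-pres : Preserves gK aK aG
    gK-pres k = g-pres (fV (inL r) k) ∘ inL-pres k

    κ-pres : Preserves κV aK aD
    κ-pres k aKk≡ = trans (aD-uncleared (κV k) (just⇒uncleared k aKk≡)) (gK-pres k aKk≡)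

    aD⊆aG : Preserves value aD aG
    aD⊆aG (v , _) aDx≡ with cleared? aK v
    ... | no _ = aDx≡

    aD⊆aH : Preserves inj₁ aD aH
    aD⊆aH x aDx≡ with cleared? aK (value x)
    ... | yes _ with () ← aDx≡
    ... | no ¬cl = trans (aD-uncleared x ¬cl) aDx≡

    -- An interface node undefined in `K` is cleared in the intermediate graph, so a defined value
    -- there forces one in `K`. The target `B` is left general to cover both `L` and `R`.
    κ-reflect : {B : Set} (i : V (K r) → B) (aB : B → Maybe X) → Preserves i aK aB →
                ∀ k {x} → aB (i k) ≡ just x → aD (κV k) ≡ just x → aK k ≡ just x
    κ-reflect i aB i-pres k aB≡ aD≡ with just-or-nothing (aK k)
    ... | inj₁ aKk≡       = contradiction
      (trans (sym (aD-cleared (κV k) (k , aKk≡ , refl))) aD≡) nothing≢just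
    ... | inj₂ (y , aKk≡) = trans aKk≡ (trans (sym (i-pres k aKk≡)) aB≡)

    -- As the attribute is total on `L`, the value at `w` exists, and `g` preserves it, so it is the
    -- one found in `G`.
    L-label : ∀ w {x} → aG (fV g w) ≡ just x → aL w ≡ just x
    L-label w aG≡ with Is-just⇒≡just (L-total w)
    ... | _ , aLw≡ = trans aLw≡ (trans (sym (g-pres w aLw≡)) aG≡)

    left-attr : Gluing (fV (inL r)) κV (fV g) value →
                AttrGluing (fV (inL r)) κV (fV g) value aK aL aD aG
    left-attr gl = record { support = support ; reflect = κ-reflect (fV (inL r)) aL inL-pres }
      where
      support : ∀ v {x} → aG v ≡ just x →
                (∃ λ w → fV g w ≡ v × aL w ≡ just x) ⊎ (∃ λ y → value y ≡ v × aD y ≡ just x)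
      support v aGv≡ with Gluing.cover gl v
      ... | inj₁ (w , refl) = inj₁ (w , refl , L-label w aGv≡)
      ... | inj₂ (y , refl) with cleared? aK (value y)
      ...   | no ¬cl = inj₂ (y , refl , trans (aD-uncleared y ¬cl) aGv≡)
      -- A value cleared in the intermediate graph is supplied by `L` at the corresponding interface
      -- node.
      ...   | yes (k , _ , gKk≡) =
        inj₁ (fV (inL r) k , gKk≡ , L-label _ (trans (cong aG gKk≡) aGv≡))

    right-attr : AttrGluing (fV (inR r)) κV attach inj₁ aK aR aD aH
    right-attr = record { support = support ; reflect = κ-reflect (fV (inR r)) aR inR-pres }
      where
      support : ∀ v {x} → aH v ≡ just x →
                (∃ λ w → attach w ≡ v × aR w ≡ just x) ⊎ (∃ λ y → inj₁ y ≡ v × aD y ≡ just x)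
      support (inj₂ w) aHv≡ = inj₁ (value w , attach-new w , aHv≡)
      support (inj₁ y) aHv≡ with cleared? aK (value y)
      ... | no ¬cl = inj₂ (y , refl , aHv≡)
      ... | yes (k , _ , gKk≡) =
        inj₁ (fV (inR r) k , trans (attach-old k) (cong inj₁ (value-injective gKk≡)) , aHv≡)

    attach-pres : Preserves attach aR aH
    attach-pres v aRv≡ with ∈VK? v
    ... | no _ = aRv≡
    ... | yes (k , refl) with just-or-nothing (aK k)
    ...   | inj₁ aKk≡       = trans (aH-cleared k aKk≡) aRv≡
    -- A value defined in `K` survives in the intermediate graph and in the result, and it is the
    -- value in `R` because `inR` preserves it.
    ...   | inj₂ (y , aKk≡) = aD⊆aH (κV k)
      (trans (κ-pres k aKk≡) (trans (sym (inR-pres k aKk≡)) aRv≡))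

    G-total⇒H-total : (∀ v → Is-just (aG v)) → ∀ v → Is-just (aH v)
    G-total⇒H-total G-total (inj₂ w) = R-total (value w)
    G-total⇒H-total G-total (inj₁ y) with cleared? aK (value y)
    ... | yes (k , _) = R-total (fV (inR r) k)
    ... | no ¬cl      = subst Is-just (sym (aD-uncleared y ¬cl)) (G-total (value y))

    -- A node in the image of `g` receives a value from `L`, which is total. Any other node is
    -- neither deleted nor cleared, so its value in the result is its value in `G`.
    H-total⇒G-total : (∀ v → Is-just (aH v)) → ∀ v → Is-just (aG v)
    H-total⇒G-total H-total v with ∈Im? (finite-V (L r)) (finite-V G) (fV g) v
    ... | yes (w , refl) with Is-just⇒≡just (L-total w)
    ...   | _ , aLw≡ = subst Is-just (sym (g-pres w aLw≡)) (just tt)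
    H-total⇒G-total H-total v | no v∉g =
      subst Is-just (aH-uncleared y ¬cl) (H-total (inj₁ y))
      where
      y : VD
      y = v , [ (λ (w , _ , gw≡v) → v∉g (w , gw≡v)) ]
      ¬cl : ¬ Cleared aK v
      ¬cl (k , _ , gKk≡v) = v∉g (fV (inL r) k , gKk≡v)

  private
    module AL = Attr (l (K r)) (l (L r)) (l (R r)) (l G) (proj₁ (L-TLRG r)) (proj₁ (R-TLRG r))
                     (pres-l (inL r)) (pres-l (inR r)) (pres-l g)
    module AP = Attr (p (K r)) (p (L r)) (p (R r)) (p G) (proj₂ (L-TLRG r)) (proj₂ (R-TLRG r))
                     (pres-p (inL r)) (pres-p (inR r)) (pres-p g)

  κ : K r ⟶ Dᴵ
  κ = record
    { fV     = κV
    ; fE     = κE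
    ; pres-s = λ e → value-injective (pres-s (g ∘ᴳ inL r) e)
    ; pres-t = λ e → value-injective (pres-t (g ∘ᴳ inL r) e)
    ; pres-m = pres-m (g ∘ᴳ inL r)
    ; pres-l = AL.κ-pres
    ; pres-p = AP.κ-pres
    }

  D⟶G : Dᴵ ⟶ G
  D⟶G = record
    { fV     = value
    ; fE     = value
    ; pres-s = λ _ → refl
    ; pres-t = λ _ → refl
    ; pres-m = λ _ → refl
    ; pres-l = AL.aD⊆aG
    ; pres-p = AP.aD⊆aG
    }

  D⟶H : Dᴵ ⟶ Hᴿ
  D⟶H = record
    { fV     = inj₁
    ; fE     = inj₁
    ; pres-s = λ _ → refl
    ; pres-t = λ _ → refl
    ; pres-m = λ _ → refl
    ; pres-l = AL.aD⊆aH
    ; pres-p = AP.aD⊆aH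
    }

  R⟶H : R r ⟶ Hᴿ
  R⟶H = record
    { fV     = attach
    ; fE     = attachE
    ; pres-s = λ e → attach-end (s (K r)) (s (R r)) (s Hᴿ) (pres-s (inR r))
                       (λ k → cong inj₁ (pres-s κ k)) (λ _ → refl) e
    ; pres-t = λ e → attach-end (t (K r)) (t (R r)) (t Hᴿ) (pres-t (inR r))
                       (λ k → cong inj₁ (pres-t κ k)) (λ _ → refl) e
    ; pres-m = attach-mark
    ; pres-l = AL.attach-pres
    ; pres-p = AP.attach-pres
    }
    where
    attach-end : (eK : E (K r) → V (K r)) (eR : E (R r) → V (R r)) (eH : EH → VH) →
                 (∀ k → fV (inR r) (eK k) ≡ eR (fE (inR r) k)) →
                 (∀ k → inj₁ (κV (eK k)) ≡ eH (inj₁ (κE k))) →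
                 (∀ (e : ER∖K) → attach (eR (value e)) ≡ eH (inj₂ e)) →
                 ∀ e → attach (eR e) ≡ eH (attachE e)
    attach-end eK eR eH inR-end κ-end new-end e with ∈EK? e
    ... | yes (k , refl) = trans (cong attach (sym (inR-end k))) (trans (attach-old (eK k)) (κ-end k))
    ... | no e∉K         = new-end (e , [ e∉K ])
    attach-mark : ∀ e → mH (attachE e) ≡ m (R r) e
    attach-mark e with ∈EK? e
    ... | yes (k , refl) = trans (pres-m κ k) (sym (pres-m (inR r) k))
    ... | no _           = refl

  application-left : GraphGluing (inL r) κ g D⟶G
  application-left = record { onV = onV ; onE = onE ; onL = AL.left-attr onV ; onP = AP.left-attr onV }
    where
    onV = complement-gluing (finite-V (K r)) (finite-V (L r)) (finite-V G)
            (proj₁ (inL-inj r)) (proj₁ g-inj) deletedV? gK-kept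
    onE = complement-gluing (finite-E (K r)) (finite-E (L r)) (finite-E G)
            (proj₂ (inL-inj r)) (proj₂ g-inj) deletedE?
            (λ e (d , d∉K , gd≡) → d∉K (e , sym (proj₂ g-inj gd≡)))

  application-right : GraphGluing (inR r) κ R⟶H D⟶H
  application-right = record
    { onV = adjunction-gluing (finite-V (K r)) (finite-V (R r))
              (proj₁ (inR-inj r)) (gK-inj ∘ cong value) attach attach-old attach-new
    ; onE = adjunction-gluing (finite-E (K r)) (finite-E (R r))
              (proj₂ (inR-inj r)) (proj₂ (inL-inj r) ∘ proj₂ g-inj ∘ cong value)
              attachE attachE-old attachE-new
    ; onL = AL.right-attr
    ; onP = AP.right-attr
    }

  application : NaturalDoublePushout r g
  application = record
    { D     = Dᴵ
    ; H     = Hᴿ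
    ; K⟶D   = κ
    ; D⟶G   = D⟶G
    ; R⟶H   = R⟶H
    ; D⟶H   = D⟶H
    ; left  = gluing⇒naturalPushout application-left
    ; right = gluing⇒naturalPushout application-right
    }

  result-TLRG : IsTLRG G ⇔ IsTLRG Hᴿ
  result-TLRG = mk⇔
    (λ (l-total , p-total) → AL.G-total⇒H-total l-total , AP.G-total⇒H-total p-total)
    (λ (l-total , p-total) → AL.H-total⇒G-total l-total , AP.H-total⇒G-total p-total)

theorem3p1 : (𝓛 : Alphabet) (r : Rule 𝓛) →
    ( (G : Graph 𝓛) (g : L r ⟶ G) (g-inj : Injective g) →
    (NaturalDoublePushout r g ⇔ Dangling r g)
    × ( (N N′ : NaturalDoublePushout r g) →
    (NaturalDoublePushout.D N ≅ NaturalDoublePushout.D N′)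
    × (NaturalDoublePushout.H N ≅ NaturalDoublePushout.H N′) )
    × ( IsTLRG G → (dang : Dangling r g) (N : NaturalDoublePushout r g) →
    (NaturalDoublePushout.D N ≅ intermediate r g g-inj dang)
    × (NaturalDoublePushout.H N ≅ result r g g-inj dang) ) )
    × ( (G H : Graph 𝓛) → G ⇒[ r ] H → (IsTLRG G ⇔ IsTLRG H) )
theorem3p1 𝓛 r =
  (λ G g g-inj →
    mk⇔ (naturalDoublePushout⇒dangling r g g-inj) (RuleApplication.application r g g-inj) ,
    naturalDoublePushout-unique r g g-inj ,
    -- The construction is itself a natural double pushout, so agreement with it is an instance of
    -- uniqueness.
    λ _ dang N → naturalDoublePushout-unique r g g-inj N (RuleApplication.application r g g-inj dang)) ,
  λ G H (g , g-inj , dang , H≅) →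
    ⇔-sym (IsTLRG-≅ H≅) ⇔-∘ RuleApplication.result-TLRG r g g-inj dang
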